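{- Let $D=(d_1,d_2,\ldots,d_n)$ be a non-negative and non-increasing integer sequence. Then $D$ is a forcibly bicyclic graphic sequence if and only if one of the following holds: (1) $D=(3^2,2^4)$, or $D=(3^3,2^2,1)$, or $D=(3^3,2^3,1)$, or $D=(4,2^6)$, or $D=(4,3,2^4,1)$, or $D=(5,2^6,1)$; (2) $D=(n-1,2^4,1^{n-5})$, where $n\ge 5$; (3) $D=(n-2,2^5,1^{n-6})$, where $n\ge 6$; (4) $D=(n-2,3,2^3,1^{n-5})$, where $n\ge 5$; (5) $D=(r,s,t,2,1^{n-4})$, where $n\ge 4$, $r\ge s\ge 3$, $t\ge 2$ and $r+s+t=n+4$.
   Context: All graphs are finite and simple. A sequence $D=(d_1,\ldots,d_n)$ of non-negative integers is graphic if there is a simple graph with vertices $v_1,\ldots,v_n$ with $\deg(v_i)=d_i$ for all $i$; such a graph is a realization of $D$. A graphic sequence $D$ is forcibly $\mathcal{P}$ graphic if every realization of $D$ has property $\mathcal{P}$. A graph of order $n$ is bicyclic if it is connected and has exactly $n+1$ edges. The notation $(a_1^{c_1},\ldots,a_k^{c_k})$ means the sequence in which $a_i$ appears $c_i$ times (exponent $0$ means the term is absent). -}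

module Defs where

open import Data.Nat using (ℕ; zero; suc; _+_; _∸_; _≤_; _≥_)
open import Data.Bool using (Bool; true; false; if_then_else_)
open import Data.Fin using (Fin; _<?_)
open import Data.List using (List; []; _∷_; _++_; length; lookup; replicate; map; allFin)
open import Data.Nat.ListAction using (sum)
open import Data.List.Relation.Unary.Linked using (Linked)
open import Data.Product using (Σ; ∃; _×_; _,_)
open import Data.Sum using (_⊎_)
open import Relation.Nullary using (¬_; yes; no)
open import Relation.Binary.PropositionalEquality using (_≡_)

record Graph (n : ℕ) : Set where
  field
    adj    : Fin n → Fin n → Bool
    sym    : ∀ i j → adj i j ≡ adj j i
    irrefl : ∀ i → adj i i ≡ false
open Graph public

deg : ∀ {n} → Graph n → Fin n → ℕ
deg {n} G i = sum (map (λ j → if adj G i j then 1 else 0) (allFin n))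

edgeCount : ∀ {n} → Graph n → ℕ
edgeCount {n} G =
  sum (map (λ i → sum (map (λ j → pairVal i j) (allFin n))) (allFin n))
  where
  pairVal : Fin n → Fin n → ℕ
  pairVal i j with i <? j
  ... | yes _ = if adj G i j then 1 else 0
  ... | no _  = 0

data Walk {n : ℕ} (G : Graph n) : Fin n → Fin n → Set where
  here : ∀ {i} → Walk G i i
  step : ∀ {i j k} → adj G i j ≡ true → Walk G j k → Walk G i k

Connected : ∀ {n} → Graph n → Set
Connected G = ∀ i j → Walk G i j

Bicyclic : ∀ {n} → Graph n → Set
Bicyclic {n} G = Connected G × edgeCount G ≡ n + 1

Realizes : (D : List ℕ) → Graph (length D) → Set
Realizes D G = ∀ i → deg G i ≡ lookup D i

Graphic : List ℕ → Set
Graphic D = Σ (Graph (length D)) (Realizes D)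

ForciblyBicyclicGraphic : List ℕ → Set
ForciblyBicyclicGraphic D =
  Graphic D × (∀ (G : Graph (length D)) → Realizes D G → Bicyclic G)

NonIncreasing : List ℕ → Set
NonIncreasing = Linked _≥_

Case1 : List ℕ → Set
Case1 D = D ≡ (3 ∷ 3 ∷ 2 ∷ 2 ∷ 2 ∷ 2 ∷ [])
        ⊎ (D ≡ (3 ∷ 3 ∷ 3 ∷ 2 ∷ 2 ∷ 1 ∷ [])
        ⊎ (D ≡ (3 ∷ 3 ∷ 3 ∷ 2 ∷ 2 ∷ 2 ∷ 1 ∷ [])
        ⊎ (D ≡ (4 ∷ 2 ∷ 2 ∷ 2 ∷ 2 ∷ 2 ∷ 2 ∷ [])
        ⊎ (D ≡ (4 ∷ 3 ∷ 2 ∷ 2 ∷ 2 ∷ 2 ∷ 1 ∷ [])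
        ⊎ D ≡ (5 ∷ 2 ∷ 2 ∷ 2 ∷ 2 ∷ 2 ∷ 2 ∷ 1 ∷ [])))))

Case2 : List ℕ → Set
Case2 D = 5 ≤ length D × D ≡ (length D ∸ 1) ∷ replicate 4 2 ++ replicate (length D ∸ 5) 1

Case3 : List ℕ → Set
Case3 D = 6 ≤ length D × D ≡ (length D ∸ 2) ∷ replicate 5 2 ++ replicate (length D ∸ 6) 1

Case4 : List ℕ → Set
Case4 D = 5 ≤ length D × D ≡ (length D ∸ 2) ∷ 3 ∷ replicate 3 2 ++ replicate (length D ∸ 5) 1

Case5 : List ℕ → Set
Case5 D = 4 ≤ length D × Σ ℕ λ r → Σ ℕ λ s → Σ ℕ λ t →
  r ≥ s × s ≥ 3 × t ≥ 2 × r + s + t ≡ length D + 4 ×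
  D ≡ r ∷ s ∷ t ∷ 2 ∷ replicate (length D ∸ 4) 1

{-# OPTIONS --safe #-}
module Submission where

-- Write the degrees of the non-leaves as 2 + x for x in a list xs. With m leaves, having n + 1 edges
-- means that the x sum to m + 2. Attaching a leaf or subdividing an edge keeps a disconnected graph
-- disconnected, so D has a disconnected realization as soon as its non-leaf degrees dominate those of
-- one of a few small disconnected graphs; going through the lists xs by length, every graphic D that
-- dominates none of them is in the list. Conversely, let D be in the list. In (5) the first three
-- degrees attain the bound d₁ + d₂ + d₃ ≤ 6 + d₄ + ... + dₙ, which forces a triangle to which all other
-- vertices are joined. In (2)-(4) one vertex is adjacent to all others but at most one. In (1) no
-- splitting of the vertices satisfies the Erdős–Gallai inequalities on both sides.

import Algebra.Properties.CommutativeMonoid.Sum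
open import Defs renaming (sym to adj-sym; irrefl to adj-irrefl)
open import Data.Bool using (Bool; true; false; if_then_else_; _∧_; _∨_; not)
open import Data.Bool.Properties using (∧-conicalˡ; ∨-comm)
import Data.Bool as Bool
open import Data.Fin using (Fin; zero; suc; toℕ; fromℕ)
open import Data.Fin.Permutation using (_⟨$⟩ʳ_; _⟨$⟩ˡ_; inverseʳ)
import Data.Fin as Fin
import Data.Fin.Properties as Fin
open import Data.Fin.Subset using (Subset; _∈_; _⊃_; ⁅_⁆; _∪_; ∁; Nonempty)
open import Data.Fin.Subset.Properties
  using (_∈?_; x∈⁅x⁆; x∈⁅y⁆⇒x≡y; x∈p∪q⁺; x∈p∪q⁻; p⊆p∪q; anySubset?; nonempty?; x∉p⇒x∈∁p; x∈∁p⇒x∉p)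
open import Data.Fin.Subset.Induction using (⊃-wellFounded; Acc; acc)
open import Data.List using (List; []; _∷_; length; lookup; map; allFin; tabulate; replicate; _++_)
open import Data.Bool.ListAction using (any)
open import Data.List.Properties using (map-tabulate; ++-identityʳ; length-map; length-++; length-replicate)
open import Data.List.Relation.Unary.Linked as Linked using (Linked; []; [-]; _∷_)
open import Data.List.Relation.Binary.Permutation.Propositional
  using (_↭_; refl; swap; ↭-sym; ↭⇒↭ₛ; module PermutationReasoning)
open import Data.List.Relation.Binary.Permutation.Propositional.Properties using (shift; shifts; ++⁺ˡ; ++-comm)
open import Data.List.Relation.Binary.Permutation.Setoid using (onIndices)
open import Data.List.Relation.Binary.Permutation.Setoid.Properties using (onIndices-lookup)
open import Data.List.Relation.Binary.Pointwise using (Pointwise; []; _∷_)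
open import Data.Nat
open import Data.Nat.Tactic.RingSolver using (solve-∀)
open import Data.Nat.ListAction using (sum)
open import Data.Nat.Properties
open import Data.Product using (Σ; ∃; ∃₂; ∃-syntax; _×_; _,_; proj₁; proj₂)
open import Data.Sum using (_⊎_; inj₁; inj₂; [_,_]′)
import Data.Vec as Vec
open import Data.Vec.Properties using (lookup⇒[]=; []=⇒lookup)
open import Data.Nat.ListAction.Properties using (sum-++)
open import Function using (_∘_; id; const)
open import Function.Bundles using (_⇔_; mk⇔; Equivalence)
open import Relation.Binary using (tri<; tri≈; tri>)
open import Relation.Binary.PropositionalEquality
open import Relation.Nullary
open import Relation.Nullary.Decidable
  using (dec-true; True; toWitness; False; toWitnessFalse; _→-dec_; _×-dec_; ¬?; ⌊_⌋; decidable-stable)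

module ∑ = Algebra.Properties.CommutativeMonoid.Sum +-0-commutativeMonoid
open ∑ using () renaming (sum to ∑)

private variable
  n : ℕ

-- Sums over vertices and the handshake lemma

ind : Bool → ℕ
ind b = if b then 1 else 0

ind≤1 : ∀ b → ind b ≤ 1
ind≤1 true  = ≤-refl
ind≤1 false = z≤n

edge : Graph n → Fin n → Fin n → ℕ
edge G i j = ind (adj G i j)

∑-mono : {f g : Fin n → ℕ} → (∀ i → f i ≤ g i) → ∑ f ≤ ∑ g
∑-mono {zero}  f≤g = z≤n
∑-mono {suc n} f≤g = +-mono-≤ (f≤g zero) (∑-mono (f≤g ∘ suc))

∑-indicator : (v : Fin n) → ∑ (λ j → ind ⌊ v Fin.≟ j ⌋) ≡ 1
∑-indicator {suc n} zero    = cong suc (∑.sum-replicate-zero n)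
∑-indicator {suc n} (suc v) = trans (∑.sum-cong-≗ (λ j → cong ind (≟-suc j))) (∑-indicator v)
  where
  ≟-suc : ∀ j → ⌊ suc v Fin.≟ suc j ⌋ ≡ ⌊ v Fin.≟ j ⌋
  ≟-suc j with v Fin.≟ j
  ... | yes _ = refl
  ... | no  _ = refl

∑-one : ∀ n → ∑ {n} (const 1) ≡ n
∑-one zero    = refl
∑-one (suc n) = cong suc (∑-one n)

sum-map-allFin : (f : Fin n → ℕ) → sum (map f (allFin n)) ≡ ∑ f
sum-map-allFin f = trans (cong sum (map-tabulate id f)) (sum-tabulate f)
  where
  sum-tabulate : ∀ {m} (g : Fin m → ℕ) → sum (tabulate g) ≡ ∑ g
  sum-tabulate {zero}  g = refl
  sum-tabulate {suc m} g = cong (g zero +_) (sum-tabulate (g ∘ suc))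

∑-lookup : (D : List ℕ) → ∑ (lookup D) ≡ sum D
∑-lookup []      = refl
∑-lookup (d ∷ D) = cong (d +_) (∑-lookup D)

deg≡∑ : (G : Graph n) (i : Fin n) → deg G i ≡ ∑ (edge G i)
deg≡∑ G i = sum-map-allFin (edge G i)

edge-sym : (G : Graph n) (i j : Fin n) → edge G i j ≡ edge G j i
edge-sym G i j = cong ind (adj-sym G i j)

edge≤deg : (G : Graph n) (i j : Fin n) → edge G i j ≤ deg G i
edge≤deg G i j = subst (edge G i j ≤_) (sym (deg≡∑ G i)) (term≤∑ (edge G i) j)
  where
  term≤∑ : ∀ {m} (f : Fin m → ℕ) j → f j ≤ ∑ f
  term≤∑ f zero    = m≤m+n _ _
  term≤∑ f (suc j) = ≤-trans (term≤∑ (f ∘ suc) j) (m≤n+m _ _)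

-- Names the local function of edgeCount, which is not in scope here.
pairs : (G : Graph n) → Σ (Fin n → Fin n → ℕ) λ p →
  edgeCount G ≡ sum (map (λ i → sum (map (p i) (allFin n))) (allFin n))
pairs G = _ , refl

-- Exactly one order of two distinct vertices is increasing, so the pair is counted once; on the
-- diagonal both sides vanish.
pairs-sym : (G : Graph n) (i j : Fin n) →
  proj₁ (pairs G) i j + proj₁ (pairs G) j i ≡ edge G i j
pairs-sym G i j with i Fin.<? j | j Fin.<? i
... | yes i<j | yes j<i = contradiction j<i (<-asym i<j)
... | yes i<j | no  _   = +-identityʳ _
... | no  _   | yes j<i = edge-sym G j i
... | no  i≮j | no  j≮i with Fin.<-cmp i j
...   | tri< i<j _ _ = contradiction i<j i≮j
...   | tri> _ _ j<i = contradiction j<i j≮i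
...   | tri≈ _ refl _ = sym (cong ind (adj-irrefl G i))

-- Adding the sum over increasing pairs to its transpose counts every adjacency in both orders.
handshake : (G : Graph n) → edgeCount G * 2 ≡ ∑ (deg G)
handshake {n} G = begin
  edgeCount G * 2
    ≡⟨ cong (_* 2) (proj₂ (pairs G)) ⟩
  sum (map (λ i → sum (map (p i) (allFin n))) (allFin n)) * 2
    ≡⟨ cong (_* 2) (trans (sum-map-allFin (λ i → sum (map (p i) (allFin n))))
                          (∑.sum-cong-≗ (λ i → sum-map-allFin (p i)))) ⟩
  P * 2
    ≡⟨ trans (*-comm P 2) (cong (P +_) (+-identityʳ P)) ⟩
  P + P
    ≡⟨ cong (P +_) (∑.∑-comm p) ⟩
  P + ∑ (λ j → ∑ (λ i → p i j))
    ≡⟨ ∑.∑-distrib-+ (λ i → ∑ (p i)) _ ⟨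
  ∑ (λ i → ∑ (p i) + ∑ (λ j → p j i))
    ≡⟨ ∑.sum-cong-≗ (λ i → sym (∑.∑-distrib-+ (p i) _)) ⟩
  ∑ (λ i → ∑ (λ j → p i j + p j i))
    ≡⟨ ∑.sum-cong-≗ (λ i → trans (∑.sum-cong-≗ (pairs-sym G i)) (sym (deg≡∑ G i))) ⟩
  ∑ (deg G) ∎
  where
  open ≡-Reasoning
  p = proj₁ (pairs G)
  P = ∑ (λ i → ∑ (p i))

-- Connectedness

-- A union of connected components, given by its characteristic function.
Compatible : Graph n → (Fin n → Bool) → Set
Compatible G c = ∀ i j → adj G i j ≡ true → c i ≡ c j

walk-compatible : {G : Graph n} {c : Fin n → Bool} → Compatible G c →
  ∀ {i j} → Walk G i j → c i ≡ c j
walk-compatible compat here       = refl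
walk-compatible compat (step e w) = trans (compat _ _ e) (walk-compatible compat w)

walk-trans : {G : Graph n} → ∀ {i j k} → Walk G i j → Walk G j k → Walk G i k
walk-trans here       w′ = w′
walk-trans (step e w) w′ = step e (walk-trans w w′)

walk-edge : {G : Graph n} → ∀ {i j} → adj G i j ≡ true → Walk G i j
walk-edge e = step e here

walk-sym : {G : Graph n} → ∀ {i j} → Walk G i j → Walk G j i
walk-sym here = here
walk-sym {G = G} (step e w) = walk-trans (walk-sym w) (walk-edge (trans (adj-sym G _ _) e))

connected-from : {G : Graph n} (r : Fin n) → (∀ i → Walk G r i) → Connected G
connected-from r reach i j = walk-trans (walk-sym (reach i)) (reach j)

Separating : Graph n → Subset n → Set
Separating G S = Compatible G (Vec.lookup S) × Nonempty S × Nonempty (∁ S)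

-- By symmetry of adjacency, a set that no edge leaves is also entered by none.
closed⇒compatible : (G : Graph n) (S : Subset n) →
  (∀ i j → i ∈ S → adj G i j ≡ true → j ∈ S) → Compatible G (Vec.lookup S)
closed⇒compatible G S closed i j e with Vec.lookup S i in eqᵢ | Vec.lookup S j in eqⱼ
... | true  | true  = refl
... | false | false = refl
... | true  | false =
  contradiction (trans (sym ([]=⇒lookup (closed i j (lookup⇒[]= i S eqᵢ) e))) eqⱼ) λ ()
... | false | true  =
  contradiction (trans (sym ([]=⇒lookup (closed j i (lookup⇒[]= j S eqⱼ) (trans (adj-sym G j i) e)))) eqᵢ) λ ()

-- Grows a set of vertices reachable from r until no edge leaves it.
reach-or-separate : (G : Graph n) (r : Fin n) → (∀ i → Walk G r i) ⊎ ∃ (Separating G)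
reach-or-separate {n} G r =
  grow ⁅ r ⁆ (x∈⁅x⁆ r) (λ i i∈ → subst (Walk G r) (sym (x∈⁅y⁆⇒x≡y r i∈)) here) (⊃-wellFounded ⁅ r ⁆)
  where
  grow : ∀ S → r ∈ S → (∀ i → i ∈ S → Walk G r i) → Acc _⊃_ S →
    (∀ i → Walk G r i) ⊎ ∃ (Separating G)
  grow S r∈S reach (acc rs)
    with Fin.any? (λ i → Fin.any? (λ j → (i ∈? S) ×-dec (adj G i j Bool.≟ true) ×-dec ¬? (j ∈? S)))
  ... | yes (i , j , i∈S , e , j∉S) =
    grow (S ∪ ⁅ j ⁆) (x∈p∪q⁺ (inj₁ r∈S))
      (λ k k∈ → [ reach k
                , (λ k∈j → subst (Walk G r) (sym (x∈⁅y⁆⇒x≡y j k∈j))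
                                 (walk-trans (reach i i∈S) (walk-edge e))) ]′ (x∈p∪q⁻ S ⁅ j ⁆ k∈))
      (rs (p⊆p∪q ⁅ j ⁆ , j , x∈p∪q⁺ (inj₂ (x∈⁅x⁆ j)) , j∉S))
  ... | no closed with Fin.all? (_∈? S)
  ...   | yes all∈S = inj₁ (λ i → reach i (all∈S i))
  ...   | no ¬all∈S with Fin.¬∀⟶∃¬ n _ (_∈? S) ¬all∈S
  ...     | j , j∉S = inj₂ (S , closed⇒compatible G S closed′ , (r , r∈S) , (j , x∉p⇒x∈∁p j∉S))
    where
    closed′ : ∀ i j → i ∈ S → adj G i j ≡ true → j ∈ S
    closed′ i j i∈S e = decidable-stable (j ∈? S) (λ j∉S → closed (i , j , i∈S , e , j∉S))

connected-if-inseparable : (G : Graph n) → (∀ S → ¬ Separating G S) → Connected G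
connected-if-inseparable {zero}  G insep ()
connected-if-inseparable {suc n} G insep with reach-or-separate G zero
... | inj₁ reach     = connected-from zero reach
... | inj₂ (S , sep) = contradiction sep (insep S)

-- Double counting of the edges between U and S, as in the Erdős–Gallai inequalities.
erdős-gallai : (G : Graph n) (d : Fin n → ℕ) → (∀ i → deg G i ≡ d i) → (S U : Fin n → Bool) →
  (∀ i j → U i ≡ true → adj G i j ≡ true → S j ≡ true) →
  ∑ (λ i → ind (U i) * d i)
    ≤ ∑ (λ j → ind (S j) * (if U j then ∑ (ind ∘ U) ∸ 1 else d j ⊓ ∑ (ind ∘ U)))
erdős-gallai {n} G d degs S U closed = begin
  ∑ (λ i → ind (U i) * d i)
    ≡⟨ ∑.sum-cong-≗ (λ i → trans (cong (ind (U i) *_) (d≡∑ i)) (*-distribˡ-∑ (ind (U i)) (edge G i))) ⟩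
  ∑ (λ i → ∑ (λ j → ind (U i) * edge G i j))
    ≡⟨ ∑.∑-comm (λ i j → ind (U i) * edge G i j) ⟩
  ∑ (λ j → ∑ (λ i → ind (U i) * edge G i j))
    ≤⟨ ∑-mono column ⟩
  ∑ (λ j → ind (S j) * (if U j then ∑ (ind ∘ U) ∸ 1 else d j ⊓ ∑ (ind ∘ U))) ∎
  where
  open ≤-Reasoning
  d≡∑ : ∀ i → d i ≡ ∑ (edge G i)
  d≡∑ i = trans (sym (degs i)) (deg≡∑ G i)
  *-distribˡ-∑ : ∀ {m} a (f : Fin m → ℕ) → a * ∑ f ≡ ∑ (λ i → a * f i)
  *-distribˡ-∑ {zero}  a f = *-zeroʳ a
  *-distribˡ-∑ {suc m} a f = trans (*-distribˡ-+ a _ _) (cong (a * f zero +_) (*-distribˡ-∑ a (f ∘ suc)))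
  term≤deg : ∀ i j → ind (U i) * edge G i j ≤ edge G j i
  term≤deg i j with U i
  ... | true  = ≤-reflexive (trans (+-identityʳ _) (edge-sym G i j))
  ... | false = z≤n
  term≤U : ∀ i j → ind (U i) * edge G i j ≤ ind (U i)
  term≤U i j = ≤-trans (*-monoʳ-≤ (ind (U i)) (ind≤1 (adj G i j))) (≤-reflexive (*-identityʳ _))
  -- A vertex `j` of `U` is not its own neighbour, so its indicator fits beside those of its
  -- neighbours in `U`. This is the source of the `∸ 1`.
  δ+term≤U : ∀ {j} → U j ≡ true → ∀ i → ind ⌊ j Fin.≟ i ⌋ + ind (U i) * edge G i j ≤ ind (U i)
  δ+term≤U {j} Uj i with j Fin.≟ i
  ... | no  _ = term≤U i j
  ... | yes refl rewrite Uj | adj-irrefl G i = ≤-refl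
  column : ∀ j → ∑ (λ i → ind (U i) * edge G i j)
    ≤ ind (S j) * (if U j then ∑ (ind ∘ U) ∸ 1 else d j ⊓ ∑ (ind ∘ U))
  -- Outside `S` the column vanishes, as edges from `U` stay in `S`. In `S` but off `U` it is
  -- bounded both by the degree and by the size of `U`.
  column j with S j in Sj
  ... | false = ≤-trans (∑-mono outside≤0) (≤-reflexive (∑.sum-replicate-zero n))
    where
    outside≤0 : ∀ i → ind (U i) * edge G i j ≤ 0
    outside≤0 i with U i in Ui | adj G i j in e
    ... | false | _     = z≤n
    ... | true  | false = z≤n
    ... | true  | true  = contradiction (trans (sym (closed i j Ui e)) Sj) λ ()
  ... | true with U j in Uj
  ...   | false = ≤-trans
    (⊓-glb (≤-trans (∑-mono (λ i → term≤deg i j)) (≤-reflexive (sym (d≡∑ j)))) (∑-mono (λ i → term≤U i j)))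
    (m≤m+n _ 0)
  ...   | true  = ≤-trans (∸-monoˡ-≤ 1 (begin
    1 + ∑ (λ i → ind (U i) * edge G i j)
      ≡⟨ cong (_+ ∑ (λ i → ind (U i) * edge G i j)) (∑-indicator j) ⟨
    ∑ (λ i → ind ⌊ j Fin.≟ i ⌋) + ∑ (λ i → ind (U i) * edge G i j)
      ≡⟨ ∑.∑-distrib-+ (λ i → ind ⌊ j Fin.≟ i ⌋) _ ⟨
    ∑ (λ i → ind ⌊ j Fin.≟ i ⌋ + ind (U i) * edge G i j)
      ≤⟨ ∑-mono (δ+term≤U Uj) ⟩
    ∑ (ind ∘ U) ∎)) (m≤m+n _ 0)

same : (Fin n → Bool) → Fin n → Fin n → Bool
same c v j = does (c v Bool.≟ c j)

-- The vertex `v` and all its neighbours share a colour.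
deg<side : (G : Graph n) (c : Fin n → Bool) → Compatible G c →
  ∀ v → deg G v < ∑ (ind ∘ same c v)
deg<side G c compat v = begin
  1 + deg G v
    ≡⟨ cong₂ _+_ (sym (∑-indicator v)) (deg≡∑ G v) ⟩
  ∑ (λ j → ind ⌊ v Fin.≟ j ⌋) + ∑ (edge G v)
    ≡⟨ ∑.∑-distrib-+ (λ j → ind ⌊ v Fin.≟ j ⌋) (edge G v) ⟨
  ∑ (λ j → ind ⌊ v Fin.≟ j ⌋ + edge G v j)
    ≤⟨ ∑-mono term ⟩
  ∑ (ind ∘ same c v) ∎
  where
  open ≤-Reasoning
  term : ∀ j → ind ⌊ v Fin.≟ j ⌋ + edge G v j ≤ ind (same c v j)
  term j with v Fin.≟ j
  ... | yes refl rewrite adj-irrefl G v | dec-true (c v Bool.≟ c v) refl = ≤-refl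
  ... | no _ with adj G v j in e
  ...   | false = z≤n
  ...   | true rewrite dec-true (c v Bool.≟ c j) (compat v j e) = ≤-refl

deg<order : (G : Graph n) → ∀ v → deg G v < n
deg<order G v = subst (deg G v <_) (∑-one _) (deg<side G (const true) (λ _ _ _ → refl) v)

-- In a split graph the side of `v` would have at least `n - 1` vertices, and the other side at
-- least two: some vertex and, its degree being positive, a neighbour.
connected-by-large-degree : (G : Graph n) (v : Fin n) → n ≤ 2 + deg G v →
  (∀ i → 1 ≤ deg G i) → Connected G
connected-by-large-degree {n} G v large pos = connected-if-inseparable G insep
  where
  opposite : ∀ a b x → a ≢ b → ind (does (a Bool.≟ x)) + ind (does (b Bool.≟ x)) ≡ 1
  opposite true  true  _     a≢b = contradiction refl a≢b
  opposite false false _     a≢b = contradiction refl a≢b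
  opposite true  false true  _   = refl
  opposite true  false false _   = refl
  opposite false true  true  _   = refl
  opposite false true  false _   = refl
  insep : ∀ S → ¬ Separating G S
  insep S (compat , (i , i∈S) , (j , j∈∁S)) = <-irrefl refl (begin-strict
    n                        ≤⟨ large ⟩
    2 + deg G v              ≤⟨ +-monoˡ-≤ (deg G v) (s≤s (pos w)) ⟩
    suc (deg G w) + deg G v  <⟨ +-mono-≤-< (deg<side G c compat w) (deg<side G c compat v) ⟩
    ∑ (ind ∘ same c w) + ∑ (ind ∘ same c v)
      ≡⟨ ∑.∑-distrib-+ (ind ∘ same c w) (ind ∘ same c v) ⟨
    -- As `w` and `v` differ in colour, each vertex lies on the side of exactly one of them.
    ∑ (λ k → ind (same c w k) + ind (same c v k))
      ≡⟨ ∑.sum-cong-≗ (λ k → opposite (c w) (c v) (c k) (proj₂ other)) ⟩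
    ∑ {n} (const 1)          ≡⟨ ∑-one n ⟩
    n                        ∎)
    where
    open ≤-Reasoning
    c : Fin n → Bool
    c = Vec.lookup S
    ci : c i ≡ true
    ci = []=⇒lookup i∈S
    cj : c j ≢ true
    cj eq = x∈∁p⇒x∉p j∈∁S (lookup⇒[]= j S eq)
    other : ∃[ w ] c w ≢ c v
    other with c v Bool.≟ true
    ... | yes eq = j , λ eq′ → cj (trans eq′ eq)
    ... | no neq = i , λ eq′ → neq (trans (sym eq′) ci)
    w : Fin n
    w = proj₁ other

-- Criteria for connectedness in terms of degrees

-- Turns equality in `FirstThree.bound` into equality at each outer vertex: slack in one term could
-- not be recovered in the others.
∑-mono-tight : {f g : Fin n → ℕ} → (∀ i → f i ≤ g i) → ∑ g ≤ ∑ f → ∀ i → g i ≤ f i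
∑-mono-tight {suc n} {f} {g} f≤g g≤f zero =
  +-cancelʳ-≤ (∑ (g ∘ suc)) _ _ (≤-trans g≤f (+-monoʳ-≤ (f zero) (∑-mono (f≤g ∘ suc))))
∑-mono-tight {suc n} {f} {g} f≤g g≤f (suc i) = ∑-mono-tight (f≤g ∘ suc)
  (+-cancelˡ-≤ (g zero) _ _ (≤-trans g≤f (+-monoˡ-≤ (∑ (f ∘ suc)) (f≤g zero)))) i

module FirstThree {m} (G : Graph (3 + m)) where

  inner : ℕ
  inner = edge G zero (suc zero) + edge G zero (suc (suc zero)) + edge G (suc zero) (suc (suc zero))

  to-outer : Fin m → ℕ
  to-outer j = edge G zero (Fin.suc (suc (suc j))) + edge G (suc zero) (Fin.suc (suc (suc j)))
    + edge G (suc (suc zero)) (Fin.suc (suc (suc j)))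

  outer-deg : Fin m → ℕ
  outer-deg j = deg G (suc (suc (suc j)))

  -- Edges inside the triple are counted from both ends, edges leaving it from one.
  deg-sum : deg G zero + deg G (suc zero) + deg G (suc (suc zero)) ≡ 2 * inner + ∑ to-outer
  deg-sum
    rewrite deg≡∑ G zero | deg≡∑ G (suc zero) | deg≡∑ G (suc (suc zero))
          | ∑.∑-distrib-+ (λ j → edge G zero (Fin.suc (suc (suc j))) + edge G (suc zero) (Fin.suc (suc (suc j))))
                          (λ j → edge G (suc (suc zero)) (Fin.suc (suc (suc j))))
          | ∑.∑-distrib-+ (λ j → edge G zero (Fin.suc (suc (suc j)))) (λ j → edge G (suc zero) (Fin.suc (suc (suc j))))
          | adj-irrefl G zero | adj-irrefl G (suc zero) | adj-irrefl G (suc (suc zero))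
          | adj-sym G (suc zero) zero | adj-sym G (suc (suc zero)) zero | adj-sym G (suc (suc zero)) (suc zero)
    = regroup (edge G zero (suc zero)) (edge G zero (suc (suc zero))) (edge G (suc zero) (suc (suc zero))) _ _ _
    where
    regroup : ∀ x y z a b c →
      (x + (y + a)) + (x + (z + b)) + (y + (z + c)) ≡ 2 * (x + y + z) + (a + b + c)
    regroup = solve-∀

  to-outer≤deg : ∀ j → to-outer j ≤ outer-deg j
  to-outer≤deg j
    rewrite deg≡∑ G (suc (suc (suc j))) | adj-sym G (suc (suc (suc j))) zero
          | adj-sym G (suc (suc (suc j))) (suc zero) | adj-sym G (suc (suc (suc j))) (suc (suc zero))
    = ≤-trans (m≤m+n _ _) (≤-reflexive (regroup (edge G zero (suc (suc (suc j)))) _ _ _))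
    where
    regroup : ∀ x y z a → x + y + z + a ≡ x + (y + (z + a))
    regroup = solve-∀

  inner≤3 : inner ≤ 3
  inner≤3 = +-mono-≤ (+-mono-≤ (ind≤1 (adj G zero (suc zero))) (ind≤1 (adj G zero (suc (suc zero)))))
                     (ind≤1 (adj G (suc zero) (suc (suc zero))))

  -- The third Erdős-Gallai inequality, with each minimum of an outer degree and 3 weakened to the
  -- degree itself.
  bound : deg G zero + deg G (suc zero) + deg G (suc (suc zero)) ≤ 6 + ∑ outer-deg
  bound = ≤-trans (≤-reflexive deg-sum) (+-mono-≤ (*-monoʳ-≤ 2 inner≤3) (∑-mono to-outer≤deg))

  -- Equality in the bound forces a triangle to which every other vertex is joined.
  connected-if-tight : 6 + ∑ outer-deg ≤ deg G zero + deg G (suc zero) + deg G (suc (suc zero)) →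
    (∀ i → 1 ≤ deg G i) → Connected G
  connected-if-tight tight pos =
    let 01-edge , 02-edge = triangle _ _ (adj G (suc zero) (suc (suc zero))) 6≤2*inner
    in connected-from zero (reach 01-edge 02-edge)
    where
    tight′ : 6 + ∑ outer-deg ≤ 2 * inner + ∑ to-outer
    tight′ = ≤-trans tight (≤-reflexive deg-sum)
    6≤2*inner : 6 ≤ 2 * inner
    6≤2*inner = +-cancelʳ-≤ (∑ outer-deg) _ _ (≤-trans tight′ (+-monoʳ-≤ (2 * inner) (∑-mono to-outer≤deg)))
    triangle : ∀ a b c → 6 ≤ 2 * (ind a + ind b + ind c) → a ≡ true × b ≡ true
    triangle true  true  _     _ = refl , refl
    triangle true  false true  (s≤s (s≤s (s≤s (s≤s ()))))
    triangle true  false false (s≤s (s≤s ()))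
    triangle false true  true  (s≤s (s≤s (s≤s (s≤s ()))))
    triangle false true  false (s≤s (s≤s ()))
    triangle false false true  (s≤s (s≤s ()))
    -- Hence all edges at an outer vertex go to the triangle, and since its degree is positive there
    -- is at least one.
    deg≤to-outer : ∀ j → outer-deg j ≤ to-outer j
    deg≤to-outer = ∑-mono-tight to-outer≤deg
      (+-cancelˡ-≤ 6 _ _ (≤-trans tight′ (+-monoˡ-≤ (∑ to-outer) (*-monoʳ-≤ 2 inner≤3))))
    reach : adj G zero (suc zero) ≡ true → adj G zero (suc (suc zero)) ≡ true → ∀ i → Walk G zero i
    reach e₁ e₂ zero             = here
    reach e₁ e₂ (suc zero)       = walk-edge e₁
    reach e₁ e₂ (suc (suc zero)) = walk-edge e₂
    reach e₁ e₂ (suc (suc (suc j)))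
      with adj G zero (suc (suc (suc j))) in f₀ | adj G (suc zero) (suc (suc (suc j))) in f₁
         | adj G (suc (suc zero)) (suc (suc (suc j))) in f₂
         | ≤-trans (pos (suc (suc (suc j)))) (deg≤to-outer j)
    ... | true  | _     | _     | _ = walk-edge f₀
    ... | false | true  | _     | _ = step e₁ (walk-edge f₁)
    ... | false | false | true  | _ = step e₂ (walk-edge f₂)
    ... | false | false | false | ()

-- Exhaustive search for a splitting of the vertices

side : Subset n → Bool → Fin n → Bool
side S x j = does (Vec.lookup S j Bool.≟ x)

initial : Subset n → Bool → Fin n → Fin n → Bool
initial S x p j = side S x j ∧ (toℕ j ≤ᵇ toℕ p)

-- Only initial segments of the vertices, which carry the largest degrees, are tested.
Erdős-Gallai : (Fin n → ℕ) → Subset n → Bool → Set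
Erdős-Gallai d S x = ∀ p → let U = initial S x p in
  ∑ (λ i → ind (U i) * d i)
    ≤ ∑ (λ j → ind (side S x j) * (if U j then ∑ (ind ∘ U) ∸ 1 else d j ⊓ ∑ (ind ∘ U)))

-- A condition on the degrees alone that is necessary for `S` to separate some realization. It is
-- decidable, so it can be refuted for all subsets by evaluation.
Separable : (Fin n → ℕ) → Subset n → Set
Separable d S = Nonempty S × Nonempty (∁ S) × Erdős-Gallai d S true × Erdős-Gallai d S false

separable? : (d : Fin n → ℕ) (S : Subset n) → Dec (Separable d S)
separable? d S = nonempty? S ×-dec nonempty? (∁ S)
  ×-dec Fin.all? (λ p → _ ≤? _) ×-dec Fin.all? (λ p → _ ≤? _)

-- Neighbours of a vertex on one side of a separation stay on that side, so `erdős-gallai` applies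
-- to both sides and contradicts the search.
connected-by-search : (d : Fin n → ℕ) → False (anySubset? (separable? d)) →
  (G : Graph n) → (∀ i → deg G i ≡ d i) → Connected G
connected-by-search d none G degs = connected-if-inseparable G λ S (compat , ne , ne∁) →
  toWitnessFalse none (S , ne , ne∁ , inequality S compat true , inequality S compat false)
  where
  inequality : ∀ S → Compatible G (Vec.lookup S) → ∀ x → Erdős-Gallai d S x
  inequality S compat x p = erdős-gallai G d degs (side S x) (initial S x p) λ i j Ui e →
    trans (cong (λ y → does (y Bool.≟ x)) (sym (compat i j e))) (∧-conicalˡ _ _ Ui)

-- Constructions of realizations

-- A realization of D with a colouring constant on components; b = false makes it disconnected.
record Coloured (b : Bool) (D : List ℕ) : Set where
  field
    graph      : Graph (length D)
    realizes   : Realizes D graph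
    colour     : Fin (length D) → Bool
    compatible : Compatible graph colour
    witnesses  : ∃₂ λ i j → colour i ≡ true × colour j ≡ b
open Coloured

coloured⇒¬connected : ∀ {D} (C : Coloured false D) → ¬ Connected (graph C)
coloured⇒¬connected C conn with witnesses C
... | i , j , cᵢ , cⱼ =
  contradiction (trans (sym cᵢ) (trans (walk-compatible (compatible C) (conn i j)) cⱼ)) λ ()

-- Relabels the vertices along the bijection of positions, so that the constructions below need only
-- act at the front of the list.
permute : ∀ {b D D′} → D ↭ D′ → Coloured b D → Coloured b D′
permute {b} {D} {D′} D↭D′ C = record
  { graph      = H
  ; realizes   = λ i → begin
      deg H i                                ≡⟨ deg≡∑ H i ⟩
      ∑ (λ j → edge (graph C) (to i) (to j)) ≡⟨ ∑.sum-permute (edge (graph C) (to i)) π ⟨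
      ∑ (edge (graph C) (to i))              ≡⟨ deg≡∑ (graph C) (to i) ⟨
      deg (graph C) (to i)                   ≡⟨ realizes C (to i) ⟩
      lookup D (to i)                        ≡⟨ onIndices-lookup (setoid ℕ) D′↭D i ⟨
      lookup D′ i                            ∎
  ; colour     = colour C ∘ to
  ; compatible = λ i j → compatible C (to i) (to j)
  ; witnesses  = let i , j , cᵢ , cⱼ = witnesses C in
      π ⟨$⟩ˡ i , π ⟨$⟩ˡ j , trans (cong (colour C) (inverseʳ π)) cᵢ , trans (cong (colour C) (inverseʳ π)) cⱼ
  }
  where
  open ≡-Reasoning
  D′↭D = ↭⇒↭ₛ (↭-sym D↭D′)
  π = onIndices D′↭D
  to = π ⟨$⟩ʳ_
  H : Graph (length D′)
  H = record
    { adj    = λ i j → adj (graph C) (to i) (to j)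
    ; sym    = λ i j → adj-sym (graph C) (to i) (to j)
    ; irrefl = λ i → adj-irrefl (graph C) (to i)
    }

-- Attaching leaves and subdividing edges

-- The new leaf is joined to the first vertex and takes its colour; the old witnesses survive.
pendant : ∀ {b d D} → Coloured b (d ∷ D) → Coloured b (1 ∷ suc d ∷ D)
pendant {b} {d} {D} C = record
  { graph      = H
  ; realizes   = λ i → trans (deg≡∑ H i) (degrees i)
  ; colour     = c′
  ; compatible = compat
  ; witnesses  = let i , j , cᵢ , cⱼ = witnesses C in suc i , suc j , cᵢ , cⱼ
  }
  where
  G = graph C
  a : Fin (2 + length D) → Fin (2 + length D) → Bool
  a zero          zero          = false
  a zero          (suc zero)    = true
  a zero          (suc (suc _)) = false
  a (suc zero)    zero          = true
  a (suc (suc _)) zero          = false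
  a (suc i)       (suc j)       = adj G i j
  a-sym : ∀ i j → a i j ≡ a j i
  a-sym zero          zero          = refl
  a-sym zero          (suc zero)    = refl
  a-sym zero          (suc (suc _)) = refl
  a-sym (suc zero)    zero          = refl
  a-sym (suc (suc _)) zero          = refl
  a-sym (suc zero)    (suc zero)    = refl
  a-sym (suc zero)    (suc (suc j)) = adj-sym G zero (suc j)
  a-sym (suc (suc i)) (suc zero)    = adj-sym G (suc i) zero
  a-sym (suc (suc i)) (suc (suc j)) = adj-sym G (suc i) (suc j)
  a-irrefl : ∀ i → a i i ≡ false
  a-irrefl zero          = refl
  a-irrefl (suc zero)    = adj-irrefl G zero
  a-irrefl (suc (suc i)) = adj-irrefl G (suc i)
  H : Graph (2 + length D)
  H = record { adj = a ; sym = a-sym ; irrefl = a-irrefl }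
  deg-in-G : ∀ i → ∑ (edge G i) ≡ lookup (d ∷ D) i
  deg-in-G i = trans (sym (deg≡∑ G i)) (realizes C i)
  degrees : ∀ i → ∑ (edge H i) ≡ lookup (1 ∷ suc d ∷ D) i
  degrees zero          = cong suc (∑.sum-replicate-zero (length D))
  degrees (suc zero)    = cong suc (deg-in-G zero)
  degrees (suc (suc i)) = deg-in-G (suc i)
  c′ : Fin (2 + length D) → Bool
  c′ zero    = colour C zero
  c′ (suc i) = colour C i
  compat : Compatible H c′
  compat zero          (suc zero)    e = refl
  compat (suc zero)    zero          e = refl
  compat (suc zero)    (suc zero)    e = refl
  compat (suc zero)    (suc (suc j)) e = compatible C zero (suc j) e
  compat (suc (suc i)) (suc zero)    e = compatible C (suc i) zero e
  compat (suc (suc i)) (suc (suc j)) e = compatible C (suc i) (suc j) e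

FirstTwoAdjacent : ∀ {b d e D} → Coloured b (d ∷ e ∷ D) → Set
FirstTwoAdjacent C = adj (graph C) zero (suc zero) ≡ true

-- The edge between the first two vertices is subdivided. The new vertex comes first and is adjacent
-- to the next one, so the operation can be iterated.
subdivide : ∀ {b d e D} → ∃ (FirstTwoAdjacent {b} {d} {e} {D}) → ∃ (FirstTwoAdjacent {b} {2} {d} {e ∷ D})
subdivide {b} {d} {e} {D} (C , 01-edge) = record
  { graph      = H
  ; realizes   = λ i → trans (deg≡∑ H i) (degrees i)
  ; colour     = c′
  ; compatible = compat
  ; witnesses  = let i , j , cᵢ , cⱼ = witnesses C in suc i , suc j , cᵢ , cⱼ
  } , refl
  where
  G = graph C
  a : Fin (3 + length D) → Fin (3 + length D) → Bool
  a zero                zero                = false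
  a zero                (suc zero)          = true
  a zero                (suc (suc zero))    = true
  a zero                (suc (suc (suc _))) = false
  a (suc zero)          zero                = true
  a (suc (suc zero))    zero                = true
  a (suc (suc (suc _))) zero                = false
  a (suc zero)          (suc (suc zero))    = false
  a (suc (suc zero))    (suc zero)          = false
  a (suc i)             (suc j)             = adj G i j
  a-sym : ∀ i j → a i j ≡ a j i
  a-sym zero                zero                = refl
  a-sym zero                (suc zero)          = refl
  a-sym zero                (suc (suc zero))    = refl
  a-sym zero                (suc (suc (suc _))) = refl
  a-sym (suc zero)          zero                = refl
  a-sym (suc (suc zero))    zero                = refl
  a-sym (suc (suc (suc _))) zero                = refl
  a-sym (suc zero)          (suc zero)          = refl
  a-sym (suc zero)          (suc (suc zero))    = refl
  a-sym (suc zero)          (suc (suc (suc j))) = adj-sym G zero (suc (suc j))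
  a-sym (suc (suc zero))    (suc zero)          = refl
  a-sym (suc (suc zero))    (suc (suc zero))    = refl
  a-sym (suc (suc zero))    (suc (suc (suc j))) = adj-sym G (suc zero) (suc (suc j))
  a-sym (suc (suc (suc i))) (suc zero)          = adj-sym G (suc (suc i)) zero
  a-sym (suc (suc (suc i))) (suc (suc zero))    = adj-sym G (suc (suc i)) (suc zero)
  a-sym (suc (suc (suc i))) (suc (suc (suc j))) = adj-sym G (suc (suc i)) (suc (suc j))
  a-irrefl : ∀ i → a i i ≡ false
  a-irrefl zero                = refl
  a-irrefl (suc zero)          = adj-irrefl G zero
  a-irrefl (suc (suc zero))    = adj-irrefl G (suc zero)
  a-irrefl (suc (suc (suc i))) = adj-irrefl G (suc (suc i))
  H : Graph (3 + length D)
  H = record { adj = a ; sym = a-sym ; irrefl = a-irrefl }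
  deg-in-G : ∀ i → ∑ (edge G i) ≡ lookup (d ∷ e ∷ D) i
  deg-in-G i = trans (sym (deg≡∑ G i)) (realizes C i)
  degrees : ∀ i → ∑ (edge H i) ≡ lookup (2 ∷ d ∷ e ∷ D) i
  degrees zero       = cong (2 +_) (∑.sum-replicate-zero (length D))
  -- Each end of the old edge trades it for an edge to the new vertex; once the known entries are
  -- rewritten the two sums agree.
  degrees (suc zero) with deg-in-G zero
  ... | eq rewrite 01-edge | adj-irrefl G zero = eq
  degrees (suc (suc zero)) with deg-in-G (suc zero)
  ... | eq rewrite adj-sym G (suc zero) zero | 01-edge = eq
  degrees (suc (suc (suc i))) = deg-in-G (suc (suc i))
  c′ : Fin (3 + length D) → Bool
  c′ zero    = colour C zero
  c′ (suc i) = colour C i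
  compat : Compatible H c′
  compat zero                (suc zero)          _ = refl
  -- The removed edge still shows that its two ends have the same colour.
  compat zero                (suc (suc zero))    _ = compatible C zero (suc zero) 01-edge
  compat (suc zero)          zero                _ = refl
  compat (suc (suc zero))    zero                _ = sym (compatible C zero (suc zero) 01-edge)
  compat (suc zero)          (suc zero)          _ = refl
  compat (suc zero)          (suc (suc (suc j))) f = compatible C zero (suc (suc j)) f
  compat (suc (suc zero))    (suc (suc zero))    _ = refl
  compat (suc (suc zero))    (suc (suc (suc j))) f = compatible C (suc zero) (suc (suc j)) f
  compat (suc (suc (suc i))) (suc zero)          f = compatible C (suc (suc i)) zero f
  compat (suc (suc (suc i))) (suc (suc zero))    f = compatible C (suc (suc i)) (suc zero) f
  compat (suc (suc (suc i))) (suc (suc (suc j))) f = compatible C (suc (suc i)) (suc (suc j)) f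

subdivide-times : ∀ k {b d e D} → ∃ (FirstTwoAdjacent {b} {d} {e} {D}) →
  Coloured b (replicate k 2 ++ d ∷ e ∷ D)
subdivide-times zero    C = proj₁ C
subdivide-times (suc k) C = permute (shift 2 (replicate k 2) _) (subdivide-times k (subdivide C))

raise : ∀ {b d D} k → Coloured b (d ∷ D) → Coloured b (k + d ∷ replicate k 1 ++ D)
raise zero    C = C
raise (suc k) C = permute (swap 1 _ refl) (pendant (raise k C))

raise-to : ∀ {b d d′ D} → d ≤ d′ → Coloured b (d ∷ D) → Coloured b (d′ ∷ replicate (d′ ∸ d) 1 ++ D)
raise-to {b} {d} {d′} {D} d≤d′ C =
  subst (λ z → Coloured b (z ∷ replicate (d′ ∸ d) 1 ++ D)) (m∸n+n≡m d≤d′) (raise (d′ ∸ d) C)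

replicate-++ : ∀ k l {x : ℕ} {D} → replicate k x ++ replicate l x ++ D ≡ replicate (k + l) x ++ D
replicate-++ zero    l = refl
replicate-++ (suc k) l = cong (_ ∷_) (replicate-++ k l)

-- The entries are raised one after another; every missing unit of degree costs one leaf, and `k` is
-- their total.
raise-all : ∀ {b h d D} → Pointwise _≤_ h d → Coloured b (h ++ D) →
  ∃ λ k → sum d ≡ sum h + k × Coloured b (d ++ replicate k 1 ++ D)
raise-all [] C = 0 , refl , C
raise-all {h = x ∷ h} {d = y ∷ d} {D = D} (x≤y ∷ h≤d) C
  -- The finished entry and its leaves move behind the entries still to be raised.
  with raise-all h≤d (permute (shifts (y ∷ replicate (y ∸ x) 1) h) (raise-to x≤y C))
... | k , eq , C′ = k + (y ∸ x) , sum-eq , permute reorder C′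
  where
  sum-eq : y + sum d ≡ x + sum h + (k + (y ∸ x))
  sum-eq = trans (cong₂ _+_ (sym (m∸n+n≡m x≤y)) eq) (regroup (y ∸ x) x (sum h) k)
    where
    regroup : ∀ u x s k → u + x + (s + k) ≡ x + s + (k + u)
    regroup = solve-∀
  reorder : d ++ replicate k 1 ++ y ∷ replicate (y ∸ x) 1 ++ D ↭ y ∷ d ++ replicate (k + (y ∸ x)) 1 ++ D
  reorder = begin
    d ++ replicate k 1 ++ y ∷ replicate (y ∸ x) 1 ++ D   ↭⟨ ++⁺ˡ d (shift y (replicate k 1) _) ⟩
    d ++ y ∷ replicate k 1 ++ replicate (y ∸ x) 1 ++ D   ↭⟨ shift y d _ ⟩
    y ∷ d ++ replicate k 1 ++ replicate (y ∸ x) 1 ++ D   ≡⟨ cong (λ z → y ∷ d ++ z) (replicate-++ k (y ∸ x)) ⟩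
    y ∷ d ++ replicate (k + (y ∸ x)) 1 ++ D              ∎
    where open PermutationReasoning

sum-map-2+ : ∀ xs → sum (map (2 +_) xs) ≡ 2 * length xs + sum xs
sum-map-2+ []       = refl
sum-map-2+ (x ∷ xs) = trans (cong (2 + x +_) (sum-map-2+ xs)) (regroup x (length xs) (sum xs))
  where
  regroup : ∀ x l s → 2 + x + (2 * l + s) ≡ 2 * (1 + l) + (x + s)
  regroup = solve-∀

-- The non-leaves have degrees 2 + x for x in xs; the m leaves follow.
degrees-from : List ℕ → ℕ → List ℕ
degrees-from xs m = map (2 +_) xs ++ replicate m 1

-- The domination step. The condition on `sum h` says that the small graph, with degrees `h` and `e`
-- leaves, has one edge more than vertices. Attaching leaves preserves this, so exactly `m` leaves
-- result.
extend : ∀ {b} xs m h e → sum xs ≡ 2 + m → sum h ≡ 2 * length xs + 2 + e →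
  Pointwise _≤_ h (map (2 +_) xs) → Coloured b (h ++ replicate e 1) → Coloured b (degrees-from xs m)
extend xs m h e Σxs Σh h≤ C with raise-all h≤ C
... | k , eq , C′ = subst (λ l → Coloured _ (map (2 +_) xs ++ l)) leaves C′
  where
  k+e≡m : k + e ≡ m
  k+e≡m = +-cancelˡ-≡ (2 * length xs + 2) _ _ (begin
    2 * length xs + 2 + (k + e)  ≡⟨ regroup (2 * length xs + 2) k e ⟩
    2 * length xs + 2 + e + k    ≡⟨ cong (_+ k) Σh ⟨
    sum h + k                    ≡⟨ eq ⟨
    sum (map (2 +_) xs)          ≡⟨ sum-map-2+ xs ⟩
    2 * length xs + sum xs       ≡⟨ cong (2 * length xs +_) Σxs ⟩
    2 * length xs + (2 + m)      ≡⟨ regroup′ (2 * length xs) m ⟩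
    2 * length xs + 2 + m        ∎)
    where
    open ≡-Reasoning
    regroup : ∀ l k e → l + (k + e) ≡ l + e + k
    regroup = solve-∀
    regroup′ : ∀ l m → l + (2 + m) ≡ l + 2 + m
    regroup′ = solve-∀
  leaves : replicate k 1 ++ replicate e 1 ≡ replicate m 1
  leaves = trans (cong (replicate k 1 ++_) (sym (++-identityʳ _)))
    (trans (replicate-++ k e) (trans (++-identityʳ _) (cong (λ z → replicate z 1) k+e≡m)))

-- Explicit small graphs

fromEdges : ∀ n → List (ℕ × ℕ) → Graph n
fromEdges n E = record
  { adj    = λ i j → not ⌊ i Fin.≟ j ⌋ ∧ (listed i j ∨ listed j i)
  ; sym    = λ i j → cong₂ _∧_ (cong not (≟-sym i j)) (∨-comm (listed i j) (listed j i))
  ; irrefl = λ i → cong (λ b → not b ∧ (listed i i ∨ listed i i)) (≟-refl i)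
  }
  where
  listed : Fin n → Fin n → Bool
  listed i j = any (λ (a , b) → (toℕ i ≡ᵇ a) ∧ (toℕ j ≡ᵇ b)) E
  ≟-refl : ∀ i → ⌊ i Fin.≟ i ⌋ ≡ true
  ≟-refl i with i Fin.≟ i
  ... | yes _  = refl
  ... | no i≢i = contradiction refl i≢i
  ≟-sym : ∀ i j → ⌊ i Fin.≟ j ⌋ ≡ ⌊ j Fin.≟ i ⌋
  ≟-sym i j with i Fin.≟ j | j Fin.≟ i
  ... | yes _   | yes _   = refl
  ... | no  _   | no  _   = refl
  ... | yes i≡j | no  j≢i = contradiction (sym i≡j) j≢i
  ... | no  i≢j | yes j≡i = contradiction (sym j≡i) i≢j

module Explicit (d : ℕ) (D : List ℕ) (k : ℕ) (E : List (ℕ × ℕ)) where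
  explicitGraph : Graph (suc (length D))
  explicitGraph = fromEdges (suc (length D)) E

  upTo-k : Fin (suc (length D)) → Bool
  upTo-k i = toℕ i <ᵇ suc k

  realizes? : Dec (Realizes (d ∷ D) explicitGraph)
  realizes? = Fin.all? λ i → deg explicitGraph i ≟ lookup (d ∷ D) i

  compatible? : Dec (Compatible explicitGraph upTo-k)
  compatible? = Fin.all? λ i → Fin.all? λ j →
    (adj explicitGraph i j Bool.≟ true) →-dec (upTo-k i Bool.≟ upTo-k j)

-- The vertices of index at most `k` form one colour class. The flag is the colour of the last
-- vertex: `true` if `k` is its index, `false` if `k` is smaller.
explicit : ∀ d D k E → let open Explicit d D k E in
  True realizes? → True compatible? → Coloured (toℕ (fromℕ (length D)) <ᵇ suc k) (d ∷ D)
explicit d D k E r c = record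
  { graph      = Explicit.explicitGraph d D k E
  ; realizes   = toWitness r
  ; colour     = Explicit.upTo-k d D k E
  ; compatible = toWitness c
  ; witnesses  = zero , fromℕ (length D) , refl , refl
  }

-- The bowtie is two triangles sharing vertex 0, the diamond is K₄ without the edge 2-3, the fan
-- joins vertex 0 to the path 3-1-2-4, and the last is the complete tripartite graph with parts {0},
-- {1}, {2,3,4}.
bowtie-edges diamond-edges K₄-edges fan-edges K₁₁₃-edges : List (ℕ × ℕ)
bowtie-edges   = (0 , 1) ∷ (1 , 2) ∷ (2 , 0) ∷ (0 , 3) ∷ (3 , 4) ∷ (4 , 0) ∷ []
diamond-edges  = (0 , 1) ∷ (0 , 2) ∷ (0 , 3) ∷ (1 , 2) ∷ (1 , 3) ∷ []
K₄-edges       = (2 , 3) ∷ diamond-edges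
fan-edges      = (0 , 1) ∷ (0 , 2) ∷ (0 , 3) ∷ (0 , 4) ∷ (3 , 1) ∷ (1 , 2) ∷ (2 , 4) ∷ []
K₁₁₃-edges     = (0 , 4) ∷ (1 , 4) ∷ diamond-edges

-- With flag `true` and a constant colouring, this is simply a realization: a diamond whose edge
-- between the vertices of degree 3 is subdivided.
bicyclic-3322 : ∀ k → Coloured true (3 ∷ 3 ∷ 2 ∷ 2 ∷ replicate k 2)
bicyclic-3322 k = permute (++-comm (replicate k 2) _)
  (subdivide-times k (explicit 3 (3 ∷ 2 ∷ 2 ∷ []) 3 diamond-edges _ _ , refl))

bicyclic-42222 : ∀ k → Coloured true (4 ∷ 2 ∷ 2 ∷ 2 ∷ 2 ∷ replicate k 2)
bicyclic-42222 k = permute (++-comm (replicate k 2) _)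
  (subdivide-times k (explicit 4 (2 ∷ 2 ∷ 2 ∷ 2 ∷ []) 4 bowtie-edges _ _ , refl))

-- With two components and one edge more than vertices, the cyclomatic numbers add up to 3. The
-- graphs from here on are a bicyclic graph with a triangle, or a tricyclic graph with a vertex or
-- an edge.
split-3322+222 : ∀ k → Coloured false (3 ∷ 3 ∷ 2 ∷ 2 ∷ 2 ∷ 2 ∷ 2 ∷ replicate k 2)
split-3322+222 k = permute (++-comm (replicate k 2) _)
  (subdivide-times k (explicit 3 (3 ∷ 2 ∷ 2 ∷ 2 ∷ 2 ∷ 2 ∷ []) 3
    ((4 , 5) ∷ (5 , 6) ∷ (6 , 4) ∷ diamond-edges) _ _ , refl))

split-42222+222 : ∀ k → Coloured false (4 ∷ 2 ∷ 2 ∷ 2 ∷ 2 ∷ 2 ∷ 2 ∷ 2 ∷ replicate k 2)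
split-42222+222 k = permute (++-comm (replicate k 2) _)
  (subdivide-times k (explicit 4 (2 ∷ 2 ∷ 2 ∷ 2 ∷ 2 ∷ 2 ∷ 2 ∷ []) 4
    ((5 , 6) ∷ (6 , 7) ∷ (7 , 5) ∷ bowtie-edges) _ _ , refl))

split-3333+11 : Coloured false (3 ∷ 3 ∷ 3 ∷ 3 ∷ 1 ∷ 1 ∷ [])
split-3333+11 = explicit _ _ 3 ((4 , 5) ∷ K₄-edges) _ _

-- An entry 0 stands for a non-leaf to be: `extend` raises it to at least 2, making it the centre of
-- a star.
split-3333+0 : Coloured false (3 ∷ 3 ∷ 3 ∷ 3 ∷ 0 ∷ [])
split-3333+0 = explicit _ _ 3 K₄-edges _ _

-- K₄ with the edge 2-3 subdivided by vertex 4.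
split-33332+0 : Coloured false (3 ∷ 3 ∷ 3 ∷ 3 ∷ 2 ∷ 0 ∷ [])
split-33332+0 = explicit _ _ 4 ((2 , 4) ∷ (4 , 3) ∷ diamond-edges) _ _

split-43322+0 : Coloured false (4 ∷ 3 ∷ 3 ∷ 2 ∷ 2 ∷ 0 ∷ [])
split-43322+0 = explicit _ _ 4 fan-edges _ _

split-43322+11 : Coloured false (4 ∷ 3 ∷ 3 ∷ 2 ∷ 2 ∷ 1 ∷ 1 ∷ [])
split-43322+11 = explicit _ _ 4 ((5 , 6) ∷ fan-edges) _ _

split-44222+0 : Coloured false (4 ∷ 4 ∷ 2 ∷ 2 ∷ 2 ∷ 0 ∷ [])
split-44222+0 = explicit _ _ 4 K₁₁₃-edges _ _

split-44222+11 : Coloured false (4 ∷ 4 ∷ 2 ∷ 2 ∷ 2 ∷ 1 ∷ 1 ∷ [])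
split-44222+11 = explicit _ _ 4 ((5 , 6) ∷ K₁₁₃-edges) _ _

-- A diamond and a triangle sharing vertex 0, next to a single edge.
split-532222+11 : Coloured false (5 ∷ 3 ∷ 2 ∷ 2 ∷ 2 ∷ 2 ∷ 1 ∷ 1 ∷ [])
split-532222+11 = explicit _ _ 5 ((6 , 7) ∷
  (0 , 1) ∷ (0 , 2) ∷ (0 , 3) ∷ (0 , 4) ∷ (0 , 5) ∷ (1 , 2) ∷ (1 , 3) ∷ (4 , 5) ∷ []) _ _

split-6222222+11 : Coloured false (6 ∷ 2 ∷ 2 ∷ 2 ∷ 2 ∷ 2 ∷ 2 ∷ 1 ∷ 1 ∷ [])
split-6222222+11 = explicit _ _ 6 ((7 , 8) ∷ (0 , 5) ∷ (5 , 6) ∷ (6 , 0) ∷ bowtie-edges) _ _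

-- Necessity

2≤2+ : ∀ {x} → 2 ≤ 2 + x
2≤2+ = m≤m+n 2 _

2+-mono : ∀ {x y} → x ≤ y → 2 + x ≤ 2 + y
2+-mono = +-monoʳ-≤ 2

sum-replicate : ∀ k a → sum (replicate k a) ≡ k * a
sum-replicate zero    a = refl
sum-replicate (suc k) a = cong (a +_) (sum-replicate k a)

length-degrees-from : ∀ xs m → length (degrees-from xs m) ≡ length xs + m
length-degrees-from xs m = trans (length-++ (map (2 +_) xs)) (cong₂ _+_ (length-map (2 +_) xs) (length-replicate m))

sum-degrees-from : ∀ xs m → sum (degrees-from xs m) ≡ 2 * length xs + sum xs + m
sum-degrees-from xs m = trans (sum-++ (map (2 +_) xs) _)
  (cong₂ _+_ (sum-map-2+ xs) (trans (sum-replicate m 1) (*-identityʳ m)))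

-- Subtracting 2 from every degree leaves `sum xs` minus `m`, which has to be 2.
sum-excess : ∀ xs m → sum (degrees-from xs m) ≡ (length (degrees-from xs m) + 1) * 2 ⇔ sum xs ≡ 2 + m
sum-excess xs m = mk⇔
  (λ eq → +-cancelˡ-≡ (2 * length xs + m) _ _ (begin
    2 * length xs + m + sum xs              ≡⟨ regroup (2 * length xs) m (sum xs) ⟩
    2 * length xs + sum xs + m              ≡⟨ sum-degrees-from xs m ⟨
    sum (degrees-from xs m)                 ≡⟨ eq ⟩
    (length (degrees-from xs m) + 1) * 2    ≡⟨ order ⟩
    2 * length xs + m + (2 + m)             ∎))
  (λ eq → begin
    sum (degrees-from xs m)                 ≡⟨ sum-degrees-from xs m ⟩
    2 * length xs + sum xs + m              ≡⟨ regroup (2 * length xs) m (sum xs) ⟨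
    2 * length xs + m + sum xs              ≡⟨ cong (2 * length xs + m +_) eq ⟩
    2 * length xs + m + (2 + m)             ≡⟨ order ⟨
    (length (degrees-from xs m) + 1) * 2    ∎)
  where
  open ≡-Reasoning
  regroup : ∀ l m s → l + m + s ≡ l + s + m
  regroup = solve-∀
  regroup′ : ∀ l m → (l + m + 1) * 2 ≡ 2 * l + m + (2 + m)
  regroup′ = solve-∀
  order : (length (degrees-from xs m) + 1) * 2 ≡ 2 * length xs + m + (2 + m)
  order = trans (cong (λ l → (l + 1) * 2) (length-degrees-from xs m)) (regroup′ (length xs) m)

sum-degrees : ∀ {D} (G : Graph (length D)) → Realizes D G → edgeCount G * 2 ≡ sum D
sum-degrees {D} G real = trans (handshake G) (trans (∑.sum-cong-≗ real) (∑-lookup D))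

connected⇒1≤deg : {G : Graph n} → Connected G → ∀ {i j} → i ≢ j → 1 ≤ deg G i
connected⇒1≤deg {G = G} conn {i} {j} i≢j with conn i j
... | here           = contradiction refl i≢j
... | step {j = k} e _ = subst (λ b → ind b ≤ deg G i) e (edge≤deg G i k)

sum-first-three : ∀ {a b c D} (G : Graph (3 + length D)) → Realizes (a ∷ b ∷ c ∷ D) G → a + b + c ≤ 6 + sum D
sum-first-three {a} {b} {c} {D} G real = begin
  a + b + c
    ≡⟨ cong₂ _+_ (cong₂ _+_ (real zero) (real (suc zero))) (real (suc (suc zero))) ⟨
  deg G zero + deg G (suc zero) + deg G (suc (suc zero))
    ≤⟨ FirstThree.bound G ⟩
  6 + ∑ (FirstThree.outer-deg G)
    ≡⟨ cong (6 +_) (trans (∑.sum-cong-≗ (λ j → real (suc (suc (suc j))))) (∑-lookup D)) ⟩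
  6 + sum D ∎
  where open ≤-Reasoning

Cases : List ℕ → Set
Cases D = Case1 D ⊎ (Case2 D ⊎ (Case3 D ⊎ (Case4 D ⊎ Case5 D)))

pattern case1 x = inj₁ x
pattern case2 x = inj₂ (inj₁ x)
pattern case3 x = inj₂ (inj₂ (inj₁ x))
pattern case4 x = inj₂ (inj₂ (inj₂ (inj₁ x)))
pattern case5 x = inj₂ (inj₂ (inj₂ (inj₂ x)))

nonIncreasing-from-0 : ∀ {ys} → Linked _≥_ (0 ∷ ys) → sum ys ≡ 0
nonIncreasing-from-0 [-]        = refl
nonIncreasing-from-0 (z≤n ∷ l) = nonIncreasing-from-0 l

2s≤ : ∀ ys → Pointwise _≤_ (replicate (length ys) 2 ++ []) (map (2 +_) ys)
2s≤ []       = []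
2s≤ (y ∷ ys) = 2≤2+ ∷ 2s≤ ys

sum-replicate-1 : ∀ m → sum (replicate m 1) ≡ m
sum-replicate-1 m = trans (sum-replicate m 1) (*-identityʳ m)

-- Graphicness excludes lists of length at most three and `(a,0,0,0)`. Every other list either
-- dominates one of the split graphs, against `nosplit`, or is one of the cases.
classify : ∀ xs m → Linked _≥_ xs → sum xs ≡ 2 + m →
  ¬ Coloured false (degrees-from xs m) → Graphic (degrees-from xs m) → Cases (degrees-from xs m)
classify [] m l () nosplit g
-- The only non-leaf would have degree `4 + m` among `1 + m` vertices.
classify (a ∷ []) m l eq nosplit (G , real) = contradiction (deg<order G zero) (≤⇒≯ (begin
  suc (length (replicate m 1)) ≡⟨ cong suc (length-replicate m) ⟩
  1 + m                        ≤⟨ m≤n+m (1 + m) 3 ⟩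
  2 + (2 + m)                  ≡⟨ cong (2 +_) (trans (sym eq) (+-identityʳ a)) ⟩
  2 + a                        ≡⟨ real zero ⟨
  deg G zero                   ∎))
  where open ≤-Reasoning
classify (a ∷ b ∷ []) zero l eq nosplit (G , real) =
  contradiction (subst (_< 2) (real zero) (deg<order G zero)) (≤⇒≯ (m≤m+n 2 a))
-- Here the third largest degree is that of a leaf; the first three sum to `8 + m`, above the bound
-- `6 + m`.
classify (a ∷ b ∷ []) (suc m) l eq nosplit (G , real) = contradiction (sum-first-three G real) (<⇒≱ (begin-strict
  6 + sum (replicate m 1)     ≡⟨ cong (6 +_) (sum-replicate-1 m) ⟩
  6 + m                       <⟨ m≤n+m (7 + m) 1 ⟩
  5 + (3 + m)                 ≡⟨ cong (5 +_) eq ⟨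
  5 + (a + (b + 0))           ≡⟨ regroup a b ⟩
  (2 + a) + (2 + b) + 1       ∎))
  where
  open ≤-Reasoning
  regroup : ∀ a b → 5 + (a + (b + 0)) ≡ (2 + a) + (2 + b) + 1
  regroup = solve-∀
classify (a ∷ b ∷ c ∷ []) m l eq nosplit (G , real) = contradiction (sum-first-three G real) (<⇒≱ (begin-strict
  6 + sum (replicate m 1)     ≡⟨ cong (6 +_) (sum-replicate-1 m) ⟩
  6 + m                       <⟨ m≤n+m (7 + m) 1 ⟩
  6 + (2 + m)                 ≡⟨ cong (6 +_) eq ⟨
  6 + (a + (b + (c + 0)))     ≡⟨ regroup a b c ⟩
  (2 + a) + (2 + b) + (2 + c) ∎))
  where
  open ≤-Reasoning
  regroup : ∀ a b c → 6 + (a + (b + (c + 0))) ≡ (2 + a) + (2 + b) + (2 + c)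
  regroup = solve-∀
classify xs@(a ∷ b ∷ c ∷ suc d ∷ []) m (b≤a ∷ c≤b ∷ d<c ∷ [-]) eq nosplit g =
  contradiction (extend xs m (3 ∷ 3 ∷ 3 ∷ 3 ∷ []) 2 eq refl
    (2+-mono (≤-trans 1≤b b≤a) ∷ 2+-mono 1≤b ∷ 2+-mono 1≤c ∷ 2+-mono (s≤s z≤n) ∷ []) split-3333+11) nosplit
  where
  1≤c = ≤-trans (s≤s z≤n) d<c
  1≤b = ≤-trans 1≤c c≤b
-- The first degree would be `4 + m`, the order of the graph.
classify (a ∷ zero ∷ zero ∷ zero ∷ []) m (_ ∷ z≤n ∷ z≤n ∷ [-]) eq nosplit (G , real) =
  contradiction (deg<order G zero) (≤⇒≯ (begin
    4 + length (replicate m 1) ≡⟨ cong (4 +_) (length-replicate m) ⟩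
    4 + m                      ≡⟨ cong (2 +_) (trans (sym eq) (+-identityʳ a)) ⟩
    2 + a                      ≡⟨ real zero ⟨
    deg G zero                 ∎))
  where open ≤-Reasoning
classify (a ∷ suc b ∷ c ∷ zero ∷ []) m (b≤a ∷ _ ∷ z≤n ∷ [-]) eq nosplit g =
  case5 ( m≤m+n 4 _ , 2 + a , 3 + b , 2 + c , 2+-mono b≤a , m≤m+n 3 b , m≤m+n 2 c
        , trans (regroup a b c) (trans (cong (6 +_) eq)
            (trans (regroup′ m) (cong (λ l → 4 + l + 4) (sym (length-replicate m)))))
        , cong (λ l → 2 + a ∷ 3 + b ∷ 2 + c ∷ 2 ∷ replicate l 1) (sym (length-replicate m)))
  where
  regroup : ∀ a b c → 2 + a + (3 + b) + (2 + c) ≡ 6 + (a + (1 + b + (c + 0)))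
  regroup = solve-∀
  regroup′ : ∀ m → 6 + (2 + m) ≡ 4 + m + 4
  regroup′ = solve-∀
classify xs@(a ∷ b ∷ c ∷ suc d ∷ e ∷ []) m (b≤a ∷ c≤b ∷ d<c ∷ _ ∷ [-]) eq nosplit g =
  contradiction (extend xs m (3 ∷ 3 ∷ 3 ∷ 3 ∷ 0 ∷ []) 0 eq refl
    (2+-mono (≤-trans 1≤b b≤a) ∷ 2+-mono 1≤b ∷ 2+-mono 1≤c ∷ 2+-mono (s≤s z≤n) ∷ z≤n ∷ []) split-3333+0) nosplit
  where
  1≤c = ≤-trans (s≤s z≤n) d<c
  1≤b = ≤-trans 1≤c c≤b
classify xs@(suc (suc a) ∷ b ∷ suc c ∷ zero ∷ zero ∷ []) m (_ ∷ c<b ∷ z≤n ∷ z≤n ∷ [-]) eq nosplit g =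
  contradiction (extend xs m (4 ∷ 3 ∷ 3 ∷ 2 ∷ 2 ∷ []) 2 eq refl
    (m≤m+n 4 a ∷ 2+-mono (≤-trans (s≤s z≤n) c<b) ∷ m≤m+n 3 c ∷ 2≤2+ ∷ 2≤2+ ∷ []) split-43322+11) nosplit
-- Once `xs` is explicit, matching the sum with `refl` determines `m`; here `m` is 1.
classify (suc zero ∷ suc zero ∷ suc zero ∷ zero ∷ zero ∷ []) m (s≤s z≤n ∷ s≤s z≤n ∷ z≤n ∷ z≤n ∷ [-]) refl nosplit g =
  case1 (inj₂ (inj₁ refl))
classify xs@(a ∷ suc (suc b) ∷ zero ∷ zero ∷ zero ∷ []) m (b<a ∷ z≤n ∷ z≤n ∷ z≤n ∷ [-]) eq nosplit g =
  contradiction (extend xs m (4 ∷ 4 ∷ 2 ∷ 2 ∷ 2 ∷ []) 2 eq refl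
    (2+-mono (≤-trans (m≤m+n 2 b) b<a) ∷ m≤m+n 4 b ∷ 2≤2+ ∷ 2≤2+ ∷ 2≤2+ ∷ []) split-44222+11) nosplit
-- The sum gives `a` the value `1 + m`, so the first degree is `3 + m`, two less than the order.
classify (a ∷ suc zero ∷ zero ∷ zero ∷ zero ∷ []) m (_ ∷ z≤n ∷ z≤n ∷ z≤n ∷ [-]) eq nosplit g =
  case4 (m≤m+n 5 _ , cong₂ (λ x l → x ∷ 3 ∷ 2 ∷ 2 ∷ 2 ∷ replicate l 1)
    (trans (cong suc (trans (+-comm 1 a) eq)) (cong (3 +_) (sym (length-replicate m)))) (sym (length-replicate m)))
classify (a ∷ zero ∷ zero ∷ zero ∷ zero ∷ []) m (_ ∷ z≤n ∷ z≤n ∷ z≤n ∷ [-]) eq nosplit g =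
  case2 (m≤m+n 5 _ , cong₂ (λ x l → x ∷ 2 ∷ 2 ∷ 2 ∷ 2 ∷ replicate l 1)
    (cong (2 +_) (trans (trans (sym (+-identityʳ a)) eq) (cong (2 +_) (sym (length-replicate m)))))
    (sym (length-replicate m)))
classify xs@(a ∷ b ∷ c ∷ suc d ∷ e ∷ f ∷ []) m (b≤a ∷ c≤b ∷ d<c ∷ _ ∷ _ ∷ [-]) eq nosplit g =
  contradiction (extend xs m (3 ∷ 3 ∷ 3 ∷ 3 ∷ 2 ∷ 0 ∷ []) 0 eq refl
    (2+-mono (≤-trans 1≤b b≤a) ∷ 2+-mono 1≤b ∷ 2+-mono 1≤c ∷ 2+-mono (s≤s z≤n) ∷ 2≤2+ ∷ z≤n ∷ []) split-33332+0) nosplit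
  where
  1≤c = ≤-trans (s≤s z≤n) d<c
  1≤b = ≤-trans 1≤c c≤b
classify xs@(suc (suc a) ∷ b ∷ suc c ∷ zero ∷ zero ∷ zero ∷ []) m (_ ∷ c<b ∷ z≤n ∷ z≤n ∷ z≤n ∷ [-]) eq nosplit g =
  contradiction (extend xs m (4 ∷ 3 ∷ 3 ∷ 2 ∷ 2 ∷ 0 ∷ []) 0 eq refl
    (m≤m+n 4 a ∷ 2+-mono (≤-trans (s≤s z≤n) c<b) ∷ m≤m+n 3 c ∷ 2≤2+ ∷ 2≤2+ ∷ z≤n ∷ []) split-43322+0) nosplit
classify (suc zero ∷ suc zero ∷ suc zero ∷ zero ∷ zero ∷ zero ∷ []) m (s≤s z≤n ∷ s≤s z≤n ∷ z≤n ∷ z≤n ∷ z≤n ∷ [-]) refl nosplit g =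
  case1 (inj₂ (inj₂ (inj₁ refl)))
classify xs@(a ∷ suc (suc b) ∷ zero ∷ zero ∷ zero ∷ zero ∷ []) m (b<a ∷ z≤n ∷ z≤n ∷ z≤n ∷ z≤n ∷ [-]) eq nosplit g =
  contradiction (extend xs m (4 ∷ 4 ∷ 2 ∷ 2 ∷ 2 ∷ 0 ∷ []) 0 eq refl
    (2+-mono (≤-trans (m≤m+n 2 b) b<a) ∷ m≤m+n 4 b ∷ 2≤2+ ∷ 2≤2+ ∷ 2≤2+ ∷ z≤n ∷ []) split-44222+0) nosplit
classify xs@(suc (suc (suc a)) ∷ suc zero ∷ zero ∷ zero ∷ zero ∷ zero ∷ []) m (_ ∷ z≤n ∷ z≤n ∷ z≤n ∷ z≤n ∷ [-]) eq nosplit g =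
  contradiction (extend xs m (5 ∷ 3 ∷ 2 ∷ 2 ∷ 2 ∷ 2 ∷ []) 2 eq refl
    (m≤m+n 5 a ∷ ≤-refl ∷ 2≤2+ ∷ 2≤2+ ∷ 2≤2+ ∷ 2≤2+ ∷ []) split-532222+11) nosplit
classify (suc (suc zero) ∷ suc zero ∷ zero ∷ zero ∷ zero ∷ zero ∷ []) m (_ ∷ z≤n ∷ z≤n ∷ z≤n ∷ z≤n ∷ [-]) refl nosplit g =
  case1 (inj₂ (inj₂ (inj₂ (inj₂ (inj₁ refl)))))
classify (suc zero ∷ suc zero ∷ zero ∷ zero ∷ zero ∷ zero ∷ []) m (_ ∷ z≤n ∷ z≤n ∷ z≤n ∷ z≤n ∷ [-]) refl nosplit g =
  case1 (inj₁ refl)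
classify (a ∷ zero ∷ zero ∷ zero ∷ zero ∷ zero ∷ []) m (_ ∷ z≤n ∷ z≤n ∷ z≤n ∷ z≤n ∷ [-]) eq nosplit g =
  case3 (m≤m+n 6 _ , cong₂ (λ x l → x ∷ 2 ∷ 2 ∷ 2 ∷ 2 ∷ 2 ∷ replicate l 1)
    (cong (2 +_) (trans (trans (sym (+-identityʳ a)) eq) (cong (2 +_) (sym (length-replicate m)))))
    (sym (length-replicate m)))
-- Seven non-leaves leave room for a diamond and a triangle; the entries of `ys` are subdivision
-- vertices.
classify xs@(a ∷ suc b ∷ c ∷ d ∷ e ∷ f ∷ g ∷ ys) m (b<a ∷ _) eq nosplit _ =
  contradiction (extend xs m (3 ∷ 3 ∷ 2 ∷ 2 ∷ 2 ∷ 2 ∷ 2 ∷ replicate (length ys) 2 ++ []) 0 eq sum-h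
    (2+-mono (≤-trans (s≤s z≤n) b<a) ∷ m≤m+n 3 b ∷ 2≤2+ ∷ 2≤2+ ∷ 2≤2+ ∷ 2≤2+ ∷ 2≤2+ ∷ 2s≤ ys)
    (subst (Coloured false) (sym (trans (++-identityʳ _) (++-identityʳ _))) (split-3322+222 (length ys)))) nosplit
  where
  sum-h : 16 + sum (replicate (length ys) 2 ++ []) ≡ 2 * (7 + length ys) + 2 + 0
  sum-h = trans (cong (λ l → 16 + sum l) (++-identityʳ (replicate (length ys) 2)))
    (trans (cong (16 +_) (sum-replicate (length ys) 2)) (regroup (length ys)))
    where
    regroup : ∀ l → 16 + l * 2 ≡ 2 * (7 + l) + 2 + 0
    regroup = solve-∀
classify xs@(a ∷ zero ∷ zero ∷ zero ∷ zero ∷ zero ∷ zero ∷ y ∷ ys) m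
  (_ ∷ z≤n ∷ z≤n ∷ z≤n ∷ z≤n ∷ z≤n ∷ l) eq nosplit _ =
  contradiction (extend xs m (4 ∷ 2 ∷ 2 ∷ 2 ∷ 2 ∷ 2 ∷ 2 ∷ 2 ∷ replicate (length ys) 2 ++ []) 0 eq sum-h
    (2+-mono 2≤a ∷ 2≤2+ ∷ 2≤2+ ∷ 2≤2+ ∷ 2≤2+ ∷ 2≤2+ ∷ 2≤2+ ∷ 2≤2+ ∷ 2s≤ ys)
    (subst (Coloured false) (sym (trans (++-identityʳ _) (++-identityʳ _))) (split-42222+222 (length ys)))) nosplit
  where
  -- All later entries are 0 by monotonicity, so `a` carries the whole sum `2 + m`.
  2≤a : 2 ≤ a
  2≤a = subst (2 ≤_) (trans (sym eq) (trans (cong (a +_) (nonIncreasing-from-0 l)) (+-identityʳ a))) (m≤m+n 2 m)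
  sum-h : 18 + sum (replicate (length ys) 2 ++ []) ≡ 2 * (8 + length ys) + 2 + 0
  sum-h = trans (cong (λ l → 18 + sum l) (++-identityʳ (replicate (length ys) 2)))
    (trans (cong (18 +_) (sum-replicate (length ys) 2)) (regroup (length ys)))
    where
    regroup : ∀ l → 18 + l * 2 ≡ 2 * (8 + l) + 2 + 0
    regroup = solve-∀
classify xs@(a ∷ zero ∷ zero ∷ zero ∷ zero ∷ zero ∷ zero ∷ []) m (_ ∷ z≤n ∷ z≤n ∷ z≤n ∷ z≤n ∷ z≤n ∷ [-]) eq nosplit _
  with m | trans (sym (+-identityʳ a)) eq
-- The first degree is `4 + m`. From two leaves on it is at least 6, enough for three triangles
-- sharing a vertex, and the two leaves give a separate edge.
... | 0 | refl = case1 (inj₂ (inj₂ (inj₂ (inj₁ refl))))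
... | 1 | refl = case1 (inj₂ (inj₂ (inj₂ (inj₂ (inj₂ refl)))))
... | suc (suc k) | refl =
  contradiction (extend xs (2 + k) (6 ∷ 2 ∷ 2 ∷ 2 ∷ 2 ∷ 2 ∷ 2 ∷ []) 2 (+-identityʳ (4 + k)) refl
    (m≤m+n 6 k ∷ 2≤2+ ∷ 2≤2+ ∷ 2≤2+ ∷ 2≤2+ ∷ 2≤2+ ∷ 2≤2+ ∷ []) split-6222222+11) nosplit

-- The remaining patterns contain an increase.
classify (_ ∷ zero ∷ suc _ ∷ _) m (_ ∷ () ∷ _)
classify (_ ∷ _ ∷ zero ∷ suc _ ∷ _) m (_ ∷ _ ∷ () ∷ _)
classify (_ ∷ _ ∷ _ ∷ zero ∷ suc _ ∷ _) m (_ ∷ _ ∷ _ ∷ () ∷ _)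
classify (_ ∷ _ ∷ _ ∷ _ ∷ zero ∷ suc _ ∷ _) m (_ ∷ _ ∷ _ ∷ _ ∷ () ∷ _)
classify (_ ∷ _ ∷ _ ∷ _ ∷ _ ∷ zero ∷ suc _ ∷ _) m (_ ∷ _ ∷ _ ∷ _ ∷ _ ∷ () ∷ _)
classify (suc zero ∷ suc (suc _) ∷ _) m (s≤s () ∷ _)
classify (_ ∷ suc zero ∷ suc (suc _) ∷ _) m (_ ∷ s≤s () ∷ _)

nonIncreasing-from-1 : ∀ D → Linked _≥_ (1 ∷ D) → (∀ i → 1 ≤ lookup D i) → D ≡ replicate (length D) 1
nonIncreasing-from-1 []      l         pos = refl
nonIncreasing-from-1 (0 ∷ D) l pos = contradiction (pos zero) λ ()
nonIncreasing-from-1 (1 ∷ D) (_ ∷ l) pos = cong (1 ∷_) (nonIncreasing-from-1 D l (pos ∘ suc))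
nonIncreasing-from-1 (suc (suc d) ∷ D) (s≤s () ∷ l) pos

split-off-leaves : ∀ D → NonIncreasing D → (∀ i → 1 ≤ lookup D i) →
  ∃₂ λ xs m → D ≡ degrees-from xs m × Linked _≥_ xs
split-off-leaves []      l pos = [] , 0 , refl , []
split-off-leaves (0 ∷ D) l pos = contradiction (pos zero) λ ()
split-off-leaves (1 ∷ D) l pos = [] , suc (length D) , cong (1 ∷_) (nonIncreasing-from-1 D l (pos ∘ suc)) , []
split-off-leaves (suc (suc x) ∷ D) l pos
  with split-off-leaves D (Linked.tail l) (pos ∘ suc)
... | [] , m , refl , l′ = x ∷ [] , m , refl , [-]
... | y ∷ xs , m , refl , l′ = x ∷ y ∷ xs , m , refl , (≤-pred (≤-pred (Linked.head l)) ∷ l′)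

necessity : ∀ D → NonIncreasing D → ForciblyBicyclicGraphic D → Cases D
-- With at most one vertex there are no edges, yet at least one is required.
necessity []          l ((G , real) , forced) = contradiction (proj₂ (forced G real)) λ ()
necessity (d ∷ [])    l ((G , real) , forced) = contradiction (proj₂ (forced G real)) λ ()
necessity D@(d ∷ e ∷ D′) l ((G , real) , forced)
  with split-off-leaves D l pos
  where
  other : ∀ (i : Fin (2 + length D′)) → ∃ (i ≢_)
  other zero    = suc zero , λ ()
  other (suc i) = zero , λ ()
  pos : ∀ i → 1 ≤ lookup D i
  pos i = subst (1 ≤_) (real i) (connected⇒1≤deg (proj₁ (forced G real)) (proj₂ (other i)))
... | xs , m , D≡ , l′ = subst Cases (sym D≡) (classify xs m l′
  (Equivalence.to (sum-excess xs m) (subst (λ D → sum D ≡ (length D + 1) * 2) D≡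
    (trans (sym (sum-degrees G real)) (cong (_* 2) (proj₂ (forced G real))))))
  (λ C → subst (λ D → ¬ Coloured false D) D≡ nosplit C)
  (subst Graphic D≡ (G , real)))
  where
  nosplit : ¬ Coloured false D
  nosplit C = coloured⇒¬connected C (proj₁ (forced (graph C) (realizes C)))

-- Sufficiency

1≤degrees-from : ∀ xs m i → 1 ≤ lookup (degrees-from xs m) i
1≤degrees-from []       (suc m) zero    = ≤-refl
1≤degrees-from []       (suc m) (suc i) = 1≤degrees-from [] m i
1≤degrees-from (x ∷ xs) m       zero    = s≤s z≤n
1≤degrees-from (x ∷ xs) m       (suc i) = 1≤degrees-from xs m i

-- The degree sum fixes the number of edges, so only connectedness has to be shown for every
-- realization; `C` provides one realization.
forcibly : ∀ xs m → sum xs ≡ 2 + m → Coloured true (degrees-from xs m) →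
  (∀ G → Realizes (degrees-from xs m) G → Connected G) → ForciblyBicyclicGraphic (degrees-from xs m)
forcibly xs m Σxs C conn = (graph C , realizes C) , λ G real → conn G real ,
  *-cancelʳ-≡ _ _ 2 (trans (sum-degrees {degrees-from xs m} G real) (Equivalence.from (sum-excess xs m) Σxs))

forcibly-by-large-degree : ∀ x xs m → sum (x ∷ xs) ≡ 2 + m → length xs + m ≤ 3 + x →
  Coloured true (degrees-from (x ∷ xs) m) → ForciblyBicyclicGraphic (degrees-from (x ∷ xs) m)
forcibly-by-large-degree x xs m Σxs large C = forcibly (x ∷ xs) m Σxs C λ G real →
  connected-by-large-degree G zero
    (≤-trans (≤-reflexive (length-degrees-from (x ∷ xs) m))
      (≤-trans (s≤s large) (≤-reflexive (cong (2 +_) (sym (real zero))))))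
    (λ i → subst (1 ≤_) (sym (real i)) (1≤degrees-from (x ∷ xs) m i))

forcibly-by-search : ∀ xs m → sum xs ≡ 2 + m → False (anySubset? (separable? (lookup (degrees-from xs m)))) →
  Coloured true (degrees-from xs m) → ForciblyBicyclicGraphic (degrees-from xs m)
forcibly-by-search xs m Σxs none C = forcibly xs m Σxs C (connected-by-search _ none)

-- The argument `_` is the search over all vertex subsets, done by evaluation. The realizations are
-- subdivided diamonds and bowties with at most one leaf.
sufficiency₁ : ∀ {D} → Case1 D → ForciblyBicyclicGraphic D
sufficiency₁ (inj₁ refl) =
  forcibly-by-search (1 ∷ 1 ∷ 0 ∷ 0 ∷ 0 ∷ 0 ∷ []) 0 refl _ (bicyclic-3322 2)
sufficiency₁ (inj₂ (inj₁ refl)) =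
  forcibly-by-search (1 ∷ 1 ∷ 1 ∷ 0 ∷ 0 ∷ []) 1 refl _
    (extend (1 ∷ 1 ∷ 1 ∷ 0 ∷ 0 ∷ []) 1 (3 ∷ 3 ∷ 2 ∷ 2 ∷ 2 ∷ []) 0 refl refl
      (≤-refl ∷ ≤-refl ∷ m≤m+n 2 1 ∷ ≤-refl ∷ ≤-refl ∷ []) (bicyclic-3322 1))
sufficiency₁ (inj₂ (inj₂ (inj₁ refl))) =
  forcibly-by-search (1 ∷ 1 ∷ 1 ∷ 0 ∷ 0 ∷ 0 ∷ []) 1 refl _
    (extend (1 ∷ 1 ∷ 1 ∷ 0 ∷ 0 ∷ 0 ∷ []) 1 (3 ∷ 3 ∷ 2 ∷ 2 ∷ 2 ∷ 2 ∷ []) 0 refl refl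
      (≤-refl ∷ ≤-refl ∷ m≤m+n 2 1 ∷ ≤-refl ∷ ≤-refl ∷ ≤-refl ∷ []) (bicyclic-3322 2))
sufficiency₁ (inj₂ (inj₂ (inj₂ (inj₁ refl)))) =
  forcibly-by-search (2 ∷ 0 ∷ 0 ∷ 0 ∷ 0 ∷ 0 ∷ 0 ∷ []) 0 refl _ (bicyclic-42222 2)
sufficiency₁ (inj₂ (inj₂ (inj₂ (inj₂ (inj₁ refl))))) =
  forcibly-by-search (2 ∷ 1 ∷ 0 ∷ 0 ∷ 0 ∷ 0 ∷ []) 1 refl _
    (extend (2 ∷ 1 ∷ 0 ∷ 0 ∷ 0 ∷ 0 ∷ []) 1 (3 ∷ 3 ∷ 2 ∷ 2 ∷ 2 ∷ 2 ∷ []) 0 refl refl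
      (m≤m+n 3 1 ∷ ≤-refl ∷ ≤-refl ∷ ≤-refl ∷ ≤-refl ∷ ≤-refl ∷ []) (bicyclic-3322 2))
sufficiency₁ (inj₂ (inj₂ (inj₂ (inj₂ (inj₂ refl))))) =
  forcibly-by-search (3 ∷ 0 ∷ 0 ∷ 0 ∷ 0 ∷ 0 ∷ 0 ∷ []) 1 refl _
    (extend (3 ∷ 0 ∷ 0 ∷ 0 ∷ 0 ∷ 0 ∷ 0 ∷ []) 1 (4 ∷ 2 ∷ 2 ∷ 2 ∷ 2 ∷ 2 ∷ 2 ∷ []) 0 refl refl
      (m≤m+n 4 1 ∷ ≤-refl ∷ ≤-refl ∷ ≤-refl ∷ ≤-refl ∷ ≤-refl ∷ ≤-refl ∷ []) (bicyclic-42222 2))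

sufficiency₂ : ∀ {D} → Case2 D → ForciblyBicyclicGraphic D
sufficiency₂ {D} (5≤n , D≡) = subst ForciblyBicyclicGraphic
  (sym (trans D≡ (cong (λ n → (n ∸ 1) ∷ replicate 4 2 ++ replicate m 1) (sym (m+[n∸m]≡n 5≤n)))))
  -- The first vertex is joined to all others, one more than the criterion asks; in cases (3) and
  -- (4) the criterion is met with equality.
  (forcibly-by-large-degree (2 + m) (0 ∷ 0 ∷ 0 ∷ 0 ∷ []) m (+-identityʳ _) (n≤1+n (4 + m))
    (extend (2 + m ∷ 0 ∷ 0 ∷ 0 ∷ 0 ∷ []) m _ 0 (+-identityʳ _) refl
      (m≤m+n 4 m ∷ ≤-refl ∷ ≤-refl ∷ ≤-refl ∷ ≤-refl ∷ []) (bicyclic-42222 0)))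
  where m = length D ∸ 5

sufficiency₃ : ∀ {D} → Case3 D → ForciblyBicyclicGraphic D
sufficiency₃ {D} (6≤n , D≡) = subst ForciblyBicyclicGraphic
  (sym (trans D≡ (cong (λ n → (n ∸ 2) ∷ replicate 5 2 ++ replicate m 1) (sym (m+[n∸m]≡n 6≤n)))))
  (forcibly-by-large-degree (2 + m) (0 ∷ 0 ∷ 0 ∷ 0 ∷ 0 ∷ []) m (+-identityʳ _) ≤-refl
    (extend (2 + m ∷ 0 ∷ 0 ∷ 0 ∷ 0 ∷ 0 ∷ []) m _ 0 (+-identityʳ _) refl
      (m≤m+n 4 m ∷ ≤-refl ∷ ≤-refl ∷ ≤-refl ∷ ≤-refl ∷ ≤-refl ∷ []) (bicyclic-42222 1)))
  where m = length D ∸ 6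

sufficiency₄ : ∀ {D} → Case4 D → ForciblyBicyclicGraphic D
sufficiency₄ {D} (5≤n , D≡) = subst ForciblyBicyclicGraphic
  (sym (trans D≡ (cong (λ n → (n ∸ 2) ∷ 3 ∷ replicate 3 2 ++ replicate m 1) (sym (m+[n∸m]≡n 5≤n)))))
  (forcibly-by-large-degree (1 + m) (1 ∷ 0 ∷ 0 ∷ 0 ∷ []) m (+-comm (1 + m) 1) ≤-refl
    (extend (1 + m ∷ 1 ∷ 0 ∷ 0 ∷ 0 ∷ []) m _ 0 (+-comm (1 + m) 1) refl
      (m≤m+n 3 m ∷ ≤-refl ∷ ≤-refl ∷ ≤-refl ∷ ≤-refl ∷ []) (bicyclic-3322 1)))
  where m = length D ∸ 5

-- With `n = 4 + m` the remaining degrees sum to `2 + m`, so `r + s + t = n + 4` is equality in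
-- `FirstThree.bound`. A diamond with leaves is a realization.
sufficiency₅ : ∀ {D} → Case5 D → ForciblyBicyclicGraphic D
sufficiency₅ {D}
  (4≤n , suc (suc a) , suc (suc (suc b)) , suc (suc c) , s≤s (s≤s b<a) , s≤s (s≤s (s≤s z≤n)) , s≤s (s≤s z≤n) , r+s+t , D≡) =
  subst ForciblyBicyclicGraphic (sym D≡)
    (forcibly (a ∷ suc b ∷ c ∷ 0 ∷ []) m Σxs
      (extend (a ∷ suc b ∷ c ∷ 0 ∷ []) m _ 0 Σxs refl
        (2+-mono (≤-trans (s≤s z≤n) b<a) ∷ m≤m+n 3 b ∷ 2≤2+ ∷ ≤-refl ∷ []) (bicyclic-3322 0))
      λ G real → FirstThree.connected-if-tight G (tight G real)
        (λ i → subst (1 ≤_) (sym (real i)) (1≤degrees-from (a ∷ suc b ∷ c ∷ 0 ∷ []) m i)))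
  where
  m = length D ∸ 4
  regroup : ∀ a b c → 6 + (a + (1 + b + (c + 0))) ≡ 2 + a + (3 + b) + (2 + c)
  regroup = solve-∀
  regroup′ : ∀ m → 4 + m + 4 ≡ 6 + (2 + m)
  regroup′ = solve-∀
  r+s+t≡8+m : 2 + a + (3 + b) + (2 + c) ≡ 6 + (2 + m)
  r+s+t≡8+m = trans r+s+t (trans (cong (_+ 4) (sym (m+[n∸m]≡n 4≤n))) (regroup′ m))
  Σxs : a + (suc b + (c + 0)) ≡ 2 + m
  Σxs = +-cancelˡ-≡ 6 _ _ (trans (regroup a b c) r+s+t≡8+m)
  tight : (G : Graph (4 + length (replicate m 1))) → Realizes (degrees-from (a ∷ suc b ∷ c ∷ 0 ∷ []) m) G →
    6 + ∑ (FirstThree.outer-deg G) ≤ deg G zero + deg G (suc zero) + deg G (suc (suc zero))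
  tight G real = ≤-reflexive (begin
    6 + ∑ (FirstThree.outer-deg G)
      ≡⟨ cong (6 +_) (trans (∑.sum-cong-≗ (λ j → real (suc (suc (suc j))))) (∑-lookup (2 ∷ replicate m 1))) ⟩
    6 + (2 + sum (replicate m 1))
      ≡⟨ cong (8 +_) (sum-replicate-1 m) ⟩
    6 + (2 + m)
      ≡⟨ r+s+t≡8+m ⟨
    2 + a + (3 + b) + (2 + c)
      ≡⟨ cong₂ _+_ (cong₂ _+_ (real zero) (real (suc zero))) (real (suc (suc zero))) ⟨
    deg G zero + deg G (suc zero) + deg G (suc (suc zero)) ∎)
    where open ≡-Reasoning

sufficiency : ∀ {D} → Cases D → ForciblyBicyclicGraphic D
sufficiency (case1 x) = sufficiency₁ x
sufficiency (case2 x) = sufficiency₂ x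
sufficiency (case3 x) = sufficiency₃ x
sufficiency (case4 x) = sufficiency₄ x
sufficiency (case5 x) = sufficiency₅ x

theorem4p1 : (D : List ℕ) → NonIncreasing D →
    ForciblyBicyclicGraphic D ⇔ (Case1 D ⊎ (Case2 D ⊎ (Case3 D ⊎ (Case4 D ⊎ Case5 D))))
theorem4p1 D nonIncreasing = mk⇔ (necessity D nonIncreasing) sufficiency
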